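{- Let $k\ge2$, let ${\bf a}$ be a $k$-automatic sequence over a finite totally ordered alphabet $\Delta$, and let ${\bf b}$ be the lexicographically least sequence in the orbit closure of ${\bf a}$. Then ${\bf b}$ is $k$-automatic.
   Context: A sequence $(a_n)_{n\ge0}$ over $\Delta$ is $k$-automatic if there is a deterministic finite automaton with output $M=(Q,\{0,\ldots,k-1\},\Delta,\delta,q_0,\tau)$ such that $a_n=\tau(\delta(q_0,w^R))$ for every base-$k$ representation $w$ of $n$ (leading zeros allowed), $w^R$ being the reversal of $w$. The orbit closure of ${\bf a}$ is the closure (in the product topology) of the set of shifts $\{(a_{n+i})_{n\ge0}:i\ge0\}$; equivalently it is the set of sequences all of whose finite prefixes are factors of ${\bf a}$. Sequences are ordered lexicographically according to the order on $\Delta$. -}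

module Defs where

open import Data.Nat using (ℕ; zero; suc; _+_; _*_; _<_)
open import Data.Fin using (Fin; toℕ)
import Data.Fin as F
open import Data.List using (List; []; _∷_; foldl; reverse)
open import Data.Product using (Σ; ∃; _×_; _,_)
open import Data.Sum using (_⊎_)
open import Relation.Binary.PropositionalEquality using (_≡_)

Seq : ℕ → Set
Seq m = ℕ → Fin m

-- Value of a base-k digit string w, most significant digit first
-- (leading zeros allowed).
val : (k : ℕ) → List (Fin k) → ℕ
val k = foldl (λ acc d → k * acc + toℕ d) 0

δ* : ∀ {s k} → (Fin s → Fin k → Fin s) → Fin s → List (Fin k) → Fin s
δ* δ = foldl δ

Automatic : (k : ℕ) {m : ℕ} → Seq m → Set
Automatic k {m} a =
  Σ ℕ λ s → Σ (Fin s → Fin k → Fin s) λ δ → Σ (Fin s) λ q0 → Σ (Fin s → Fin m) λ τ →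
    ∀ (w : List (Fin k)) → a (val k w) ≡ τ (δ* δ q0 (reverse w))

InOrbitClosure : ∀ {m} → Seq m → Seq m → Set
InOrbitClosure a b = ∀ (N : ℕ) → ∃ λ i → ∀ j → j < N → b j ≡ a (i + j)

LexLeq : ∀ {m} → Seq m → Seq m → Set
LexLeq b c = (∀ n → b n ≡ c n)
           ⊎ (∃ λ n → (∀ i → i < n → b i ≡ c i) × (b n F.< c n))

IsLexLeastInOrbitClosure : ∀ {m} → Seq m → Seq m → Set
IsLexLeastInOrbitClosure a b =
  InOrbitClosure a b × (∀ c → InOrbitClosure a c → LexLeq b c)

{-# OPTIONS --safe #-}

-- Reading least significant digit first, the words y n = (values at n and n + 1
-- of all state sequences of a) form a sequence over a finite alphabet with
-- y (k n + t) = U t (y n) for t ≤ 2k − 2, so the block of length k that starts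
-- at position k i + d + k n is a function of d and of the single letter y (i + n).
-- Fix a total preorder P on the letters. Some residue d mod k contains starting
-- positions of P-least factors of every length; cutting those factors into blocks
-- gives factors that are least for the preorder "compare blocks
-- lexicographically under P". There are finitely many preorders, so following
-- P ↦ (next preorder), together with the output map f on letters, is a finite
-- automaton for the least sequence.
--
-- Choosing d, and the least letter occurring in y, is not effective, so the
-- automaton is obtained only under ¬¬. Its number of states is explicit,
-- however, and two machines with S states that agree on words of length
-- at most S² agree everywhere: a finite search against b recovers it.

module Submission where

open import Defs
open import Data.Nat hiding (_!)
open import Data.Nat.Properties
open import Data.Nat.DivMod
open import Data.Nat.Induction using (<-rec)
open import Data.Nat.Solver using (module +-*-Solver)
open import Data.Fin using (Fin; zero; suc; toℕ; finToFun; funToFin; combine; remQuot; fromℕ<)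
open import Data.Fin.Properties as Fin using
  (toℕ<n; toℕ-fromℕ<; toℕ-injective; finToFun-funToFin; remQuot-combine)
open import Data.List using (List; []; _∷_; _++_; _∷ʳ_; foldl; foldr; length; take; drop; reverse)
open import Data.List.Properties using
  ( foldl-++; foldl-∷ʳ; length-++; length-take; length-drop; take++drop≡id
  ; reverse-foldl; reverse-foldr; reverse-involutive )
open import Data.List.Reverse using (Reverse; []; _∶_∶ʳ_; reverseView)
open import Data.Product using (∃; ∃-syntax; _×_; _,_; proj₁; proj₂)
open import Data.Sum using (_⊎_; inj₁; inj₂)
open import Effect.Monad using (RawMonad)
open import Function using (_∘_; case_of_)
open import Relation.Binary using (tri<; tri≈; tri>)
open import Relation.Binary.PropositionalEquality
open import Relation.Nullary using (¬_; Dec; yes; no; contradiction)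
open import Relation.Nullary.Decidable using (decidable-stable; map′; _×-dec_)
open import Relation.Nullary.Negation using (¬¬-Monad; ¬¬-map)

-- Choice and minimum principles under double negation.

¬¬-sequence : ∀ {n} {P : Fin n → Set} → (∀ i → ¬ ¬ P i) → ¬ ¬ (∀ i → P i)
¬¬-sequence = Fin.sequence (RawMonad.rawApplicative ¬¬-Monad)

-- Strong induction on the value: if `v i ≡ n` and no smaller number is a value, then `i` is a
-- minimum, so denying a minimum rules out every value.
¬¬-minimum : (v : ℕ → ℕ) → ¬ ¬ (∃[ i ] ∀ j → v i ≤ v j)
¬¬-minimum v ¬min = <-rec (λ n → ∀ i → v i ≢ n) step (v 0) 0 refl
  where
  step : ∀ n → (∀ {n′} → n′ < n → ∀ i → v i ≢ n′) → ∀ i → v i ≢ n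
  step n below i refl = ¬min (i , λ j → ≮⇒≥ (λ vj<vi → below vj<vi j refl))

-- Lexicographic comparison of prefixes.

AgreeBelow : ℕ → (ℕ → ℕ) → (ℕ → ℕ) → Set
AgreeBelow N g h = ∀ n → n < N → g n ≡ h n

FirstLess : ℕ → (ℕ → ℕ) → (ℕ → ℕ) → Set
FirstLess N g h = ∃[ p ] p < N × AgreeBelow p g h × g p < h p

Lex≤ : ℕ → (ℕ → ℕ) → (ℕ → ℕ) → Set
Lex≤ N g h = AgreeBelow N g h ⊎ FirstLess N g h

Lex≤-map : ∀ {N g h g′ h′} →
  (∀ n → g n ≡ h n → g′ n ≡ h′ n) → (∀ n → g n < h n → g′ n < h′ n) →
  Lex≤ N g h → Lex≤ N g′ h′
Lex≤-map on≡ on< (inj₁ eq) = inj₁ (λ n n<N → on≡ n (eq n n<N))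
Lex≤-map on≡ on< (inj₂ (p , p<N , eq , lt)) =
  inj₂ (p , p<N , (λ n n<p → on≡ n (eq n n<p)) , on< p lt)

Lex≤-restrict : ∀ {N M g h} → N ≤ M → Lex≤ M g h → Lex≤ N g h
Lex≤-restrict N≤M (inj₁ eq) = inj₁ (λ n n<N → eq n (<-≤-trans n<N N≤M))
Lex≤-restrict {N} N≤M (inj₂ (p , _ , eq , lt)) with p <? N
... | yes p<N = inj₂ (p , p<N , eq , lt)
... | no  p≮N = inj₁ (λ n n<N → eq n (<-≤-trans n<N (≮⇒≥ p≮N)))

FirstLess-suc : ∀ {N g h} → FirstLess N g h → FirstLess (suc N) g h
FirstLess-suc (p , p<N , rest) = p , m<n⇒m<1+n p<N , rest

lex-compare : ∀ N g h → AgreeBelow N g h ⊎ FirstLess N g h ⊎ FirstLess N h g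
lex-compare zero g h = inj₁ (λ _ ())
lex-compare (suc N) g h with lex-compare N g h
... | inj₂ (inj₁ lt) = inj₂ (inj₁ (FirstLess-suc lt))
... | inj₂ (inj₂ gt) = inj₂ (inj₂ (FirstLess-suc gt))
... | inj₁ eq with <-cmp (g N) (h N)
...   | tri< lt _ _ = inj₂ (inj₁ (N , ≤-refl , eq , lt))
...   | tri> _ _ gt = inj₂ (inj₂ (N , ≤-refl , (λ n n<N → sym (eq n n<N)) , gt))
...   | tri≈ _ gN≡hN _ = inj₁ agree
  where
  agree : AgreeBelow (suc N) g h
  agree n n<1+N with m<1+n⇒m<n∨m≡n n<1+N
  ... | inj₁ n<N  = eq n n<N
  ... | inj₂ refl = gN≡hN

-- Prefixes as base-`R` numerals.

value : ℕ → (ℕ → ℕ) → ℕ → ℕ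
value R g zero    = 0
value R g (suc N) = value R g N * R + g N

value-cong : ∀ R {g h} N → AgreeBelow N g h → value R g N ≡ value R h N
value-cong R zero    eq = refl
value-cong R (suc N) eq =
  cong₂ (λ v d → v * R + d) (value-cong R N (λ n n<N → eq n (m<n⇒m<1+n n<N))) (eq N ≤-refl)

carry-< : ∀ {R a b x y} → a < b → x < R → a * R + x < b * R + y
carry-< {R} {a} {b} {x} {y} a<b x<R = begin-strict
  a * R + x  <⟨ +-monoʳ-< (a * R) x<R ⟩
  a * R + R  ≡⟨ +-comm (a * R) R ⟩
  suc a * R  ≤⟨ *-monoˡ-≤ R a<b ⟩
  b * R      ≤⟨ m≤m+n (b * R) y ⟩
  b * R + y  ∎
  where open ≤-Reasoning

value-< : ∀ {R g} N → (∀ n → g n < R) → value R g N < R ^ N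
value-< zero    g<R = s≤s z≤n
value-< {R} {g} (suc N) g<R = begin-strict
  value R g N * R + g N  <⟨ carry-< {b = R ^ N} {y = 0} (value-< N g<R) (g<R N) ⟩
  R ^ N * R + 0          ≡⟨ +-identityʳ _ ⟩
  R ^ N * R              ≡⟨ *-comm (R ^ N) R ⟩
  R ^ suc N              ∎
  where open ≤-Reasoning

-- At the first difference the left numeral falls behind by at least one unit, and later digits
-- below `R` cannot make this up.
FirstLess⇒value-< : ∀ {R g h} N → (∀ n → g n < R) → FirstLess N g h → value R g N < value R h N
FirstLess⇒value-< {R} {g} {h} (suc N) g<R (p , p<1+N , eq , lt) with m<1+n⇒m<n∨m≡n p<1+N
... | inj₁ p<N  = carry-< (FirstLess⇒value-< N g<R (p , p<N , eq , lt)) (g<R N)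
... | inj₂ refl = subst (λ v → value R g N * R + g N < v * R + h N)
                    (value-cong R N eq) (+-monoʳ-< (value R g N * R) lt)

Lex≤⇒value-≤ : ∀ {R g h} N → (∀ n → g n < R) → Lex≤ N g h → value R g N ≤ value R h N
Lex≤⇒value-≤ {R} N g<R (inj₁ eq) = ≤-reflexive (value-cong R N eq)
Lex≤⇒value-≤ N g<R (inj₂ lt) = <⇒≤ (FirstLess⇒value-< N g<R lt)

value-≤⇒Lex≤ : ∀ {R g h} N → (∀ n → h n < R) → value R g N ≤ value R h N → Lex≤ N g h
value-≤⇒Lex≤ {g = g} {h} N h<R v≤v with lex-compare N g h
... | inj₁ eq        = inj₁ eq
... | inj₂ (inj₁ lt) = inj₂ lt
... | inj₂ (inj₂ gt) = contradiction (FirstLess⇒value-< N h<R gt) (≤⇒≯ v≤v)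

value-injective : ∀ {R g h} N → (∀ n → g n < R) → (∀ n → h n < R) →
  value R g N ≡ value R h N → AgreeBelow N g h
value-injective {g = g} {h} N g<R h<R v≡v with lex-compare N g h
... | inj₁ eq        = eq
... | inj₂ (inj₁ lt) = contradiction v≡v (<⇒≢ (FirstLess⇒value-< N g<R lt))
... | inj₂ (inj₂ gt) = contradiction (sym v≡v) (<⇒≢ (FirstLess⇒value-< N h<R gt))

value-+ : ∀ R g M N → value R g (M + N) ≡ value R g M * R ^ N + value R (λ n → g (M + n)) N
value-+ R g M zero = begin
  value R g (M + 0)      ≡⟨ cong (value R g) (+-identityʳ M) ⟩
  value R g M            ≡⟨ *-identityʳ _ ⟨
  value R g M * 1        ≡⟨ +-identityʳ _ ⟨
  value R g M * 1 + 0    ∎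
  where open ≡-Reasoning
value-+ R g M (suc N) = begin
  value R g (M + suc N)                    ≡⟨ cong (value R g) (+-suc M N) ⟩
  value R g (M + N) * R + g (M + N)        ≡⟨ cong (λ v → v * R + g (M + N)) (value-+ R g M N) ⟩
  (A * R ^ N + B) * R + g (M + N)          ≡⟨ solve 5 (λ a p b r x →
                                                (a :* p :+ b) :* r :+ x := a :* (r :* p) :+ (b :* r :+ x))
                                                refl A (R ^ N) B R (g (M + N)) ⟩
  A * R ^ suc N + (B * R + g (M + N))      ∎
  where
  open ≡-Reasoning
  open +-*-Solver
  A = value R g M
  B = value R (λ n → g (M + n)) N

-- Reading `k` digits at a time gives a numeral in base `R ^ k`; comparing factors thus becomes
-- comparing sequences of blocks.
value-blocks : ∀ R g k N →
  value R g (k * N) ≡ value (R ^ k) (λ n → value R (λ s → g (k * n + s)) k) N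
value-blocks R g k zero    = cong (value R g) (*-zeroʳ k)
value-blocks R g k (suc N) = begin
  value R g (k * suc N)    ≡⟨ cong (value R g) (trans (*-suc k N) (+-comm k (k * N))) ⟩
  value R g (k * N + k)    ≡⟨ value-+ R g (k * N) k ⟩
  value R g (k * N) * R ^ k + value R (λ s → g (k * N + s)) k
    ≡⟨ cong (λ v → v * R ^ k + value R (λ s → g (k * N + s)) k) (value-blocks R g k N) ⟩
  value (R ^ k) _ (suc N)  ∎
  where open ≡-Reasoning

-- Rankings of a finite alphabet.

countBelow : ∀ {ℓ} → (Fin ℓ → ℕ) → ℕ → ℕ
countBelow {zero}  v b = 0
countBelow {suc ℓ} v b with v zero <? b
... | yes _ = suc (countBelow (v ∘ suc) b)
... | no  _ = countBelow (v ∘ suc) b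

countBelow-≤ : ∀ {ℓ} (v : Fin ℓ → ℕ) b → countBelow v b ≤ ℓ
countBelow-≤ {zero}  v b = z≤n
countBelow-≤ {suc ℓ} v b with v zero <? b
... | yes _ = s≤s (countBelow-≤ (v ∘ suc) b)
... | no  _ = m≤n⇒m≤1+n (countBelow-≤ (v ∘ suc) b)

countBelow-mono : ∀ {ℓ} (v : Fin ℓ → ℕ) {b c} → b ≤ c → countBelow v b ≤ countBelow v c
countBelow-mono {zero}  v b≤c = z≤n
countBelow-mono {suc ℓ} v {b} {c} b≤c with v zero <? b | v zero <? c
... | yes _  | yes _   = s≤s (countBelow-mono (v ∘ suc) b≤c)
... | yes lt | no  ≮c  = contradiction (<-≤-trans lt b≤c) ≮c
... | no  _  | yes _   = m≤n⇒m≤1+n (countBelow-mono (v ∘ suc) b≤c)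
... | no  _  | no  _   = countBelow-mono (v ∘ suc) b≤c

-- The index `u` itself is counted below `c` but not below `v u`, hence strictness.
countBelow-< : ∀ {ℓ} (v : Fin ℓ → ℕ) u {c} → v u < c → countBelow v (v u) < countBelow v c
countBelow-< v zero {c} lt with v zero <? v zero | v zero <? c
... | yes <self | _      = contradiction <self (<-irrefl refl)
... | no  _     | yes _  = s≤s (countBelow-mono (v ∘ suc) (<⇒≤ lt))
... | no  _     | no  ≮c = contradiction lt ≮c
countBelow-< v (suc u) {c} lt with v zero <? v (suc u) | v zero <? c
... | yes _   | yes _  = s≤s (countBelow-< (v ∘ suc) u lt)
... | yes lt′ | no  ≮c = contradiction (<-trans lt′ lt) ≮c
... | no  _   | yes _  = m<n⇒m<1+n (countBelow-< (v ∘ suc) u lt)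
... | no  _   | no  _  = countBelow-< (v ∘ suc) u lt

-- Storing a code instead of a function makes tables a finite type without function extensionality.
record Table (ℓ n : ℕ) : Set where
  constructor coded
  field code : Fin (n ^ ℓ)

  infix 8 _!_
  _!_ : Fin ℓ → Fin n
  _!_ = finToFun code

open Table using (_!_)

tabulate : ∀ {ℓ n} → (Fin ℓ → Fin n) → Table ℓ n
tabulate f = coded (funToFin f)

!-tabulate : ∀ {ℓ n} (f : Fin ℓ → Fin n) u → tabulate f ! u ≡ f u
!-tabulate f u = finToFun-funToFin f u

-- A preorder on Fin ℓ is stored as a table of ranks; compress brings an
-- arbitrary ranking v back to ranks at most ℓ by counting the smaller values.
rank : ∀ {ℓ} → Table ℓ (suc ℓ) → Fin ℓ → ℕ
rank P u = toℕ (P ! u)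

compress : ∀ {ℓ} → (Fin ℓ → ℕ) → Table ℓ (suc ℓ)
compress v = tabulate (λ u → fromℕ< (s≤s (countBelow-≤ v (v u))))

rank-compress : ∀ {ℓ} (v : Fin ℓ → ℕ) u → rank (compress v) u ≡ countBelow v (v u)
rank-compress v u = trans (cong toℕ (!-tabulate _ u)) (toℕ-fromℕ< _)

compress-≡ : ∀ {ℓ} (v : Fin ℓ → ℕ) {u w} → v u ≡ v w → rank (compress v) u ≡ rank (compress v) w
compress-≡ v {u} {w} eq =
  trans (rank-compress v u) (trans (cong (countBelow v) eq) (sym (rank-compress v w)))

compress-< : ∀ {ℓ} (v : Fin ℓ → ℕ) {u w} → v u < v w → rank (compress v) u < rank (compress v) w
compress-< v {u} {w} lt =
  subst₂ _<_ (sym (rank-compress v u)) (sym (rank-compress v w)) (countBelow-< v u lt)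

compress-≡⁻¹ : ∀ {ℓ} (v : Fin ℓ → ℕ) {u w} → rank (compress v) u ≡ rank (compress v) w → v u ≡ v w
compress-≡⁻¹ v {u} {w} eq with <-cmp (v u) (v w)
... | tri< lt _ _ = contradiction eq (<⇒≢ (compress-< v lt))
... | tri≈ _ e _  = e
... | tri> _ _ gt = contradiction (sym eq) (<⇒≢ (compress-< v gt))

-- Automata reading the least significant digit first, and finite state sets.

lsbVal : (k : ℕ) → List (Fin k) → ℕ
lsbVal k = foldr (λ d n → k * n + toℕ d) 0

record Machine (k m : ℕ) (Q : Set) : Set where
  constructor machine
  field
    δ  : Q → Fin k → Q
    q0 : Q
    τ  : Q → Fin m

  run : List (Fin k) → Fin m
  run w = τ (foldl δ q0 w)

open Machine using (run)

Generates : ∀ {k m Q} → Machine k m Q → Seq m → Set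
Generates {k} M a = ∀ w → a (lsbVal k w) ≡ run M w

record Finite (Q : Set) (n : ℕ) : Set where
  field
    enc     : Q → Fin n
    dec     : Fin n → Q
    dec-enc : ∀ q → dec (enc q) ≡ q

-- Finiteness of `Q` is what lets a double negation move outside the quantifier; it replaces a
-- choice made separately for each order.
¬¬-Π : ∀ {Q n} → Finite Q n → {P : Q → Set} → (∀ q → ¬ ¬ P q) → ¬ ¬ (∀ q → P q)
¬¬-Π F {P} ¬¬P =
  ¬¬-map (λ p q → subst P (dec-enc q) (p (enc q))) (¬¬-sequence (λ i → ¬¬P (dec i)))
  where open Finite F

Finite-× : ∀ {A B : Set} {m n} → Finite A m → Finite B n → Finite (A × B) (m * n)
Finite-× {m = m} {n} FA FB = record
  { enc     = λ (a , b) → combine (A.enc a) (B.enc b)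
  ; dec     = λ i → A.dec (proj₁ (remQuot {m} n i)) , B.dec (proj₂ (remQuot {m} n i))
  ; dec-enc = λ (a , b) → trans
      (cong (λ ij → A.dec (proj₁ ij) , B.dec (proj₂ ij)) (remQuot-combine {m} {n} (A.enc a) (B.enc b)))
      (cong₂ _,_ (A.dec-enc a) (B.dec-enc b))
  }
  where
  module A = Finite FA
  module B = Finite FB

Finite-Fin : ∀ {n} → Finite (Fin n) n
Finite-Fin = record { enc = λ i → i ; dec = λ i → i ; dec-enc = λ _ → refl }

Finite-Table : ∀ {ℓ n} → Finite (Table ℓ n) (n ^ ℓ)
Finite-Table = record { enc = Table.code ; dec = coded ; dec-enc = λ _ → refl }

module _ {k m Q n} (F : Finite Q n) (M : Machine k m Q) where
  open Finite F
  open Machine M hiding (run)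

  encode : Machine k m (Fin n)
  encode = machine (λ i d → enc (δ (dec i) d)) (enc q0) (λ i → τ (dec i))

  run-encode : ∀ w → run encode w ≡ run M w
  run-encode w = cong τ (trans (go w (enc q0)) (cong (λ q → foldl δ q w) (dec-enc q0)))
    where
    go : ∀ w i → dec (foldl (Machine.δ encode) i w) ≡ foldl δ (dec i) w
    go []      i = refl
    go (d ∷ w) i = trans (go w _) (cong (λ q → foldl δ q w) (dec-enc _))

divide : ∀ k .{{_ : NonZero k}} n → k * (n / k) + toℕ (n mod k) ≡ n
divide k n = begin
  k * (n / k) + toℕ (n mod k) ≡⟨ cong₂ _+_ (*-comm k (n / k)) (toℕ-fromℕ< _) ⟩
  n / k * k + n % k           ≡⟨ +-comm _ (n % k) ⟩
  n % k + n / k * k           ≡⟨ m≡m%n+[m/n]*n n k ⟨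
  n                           ∎
  where open ≡-Reasoning

-- Least factors and their division into blocks.

module Blocks (k ℓ m : ℕ) .{{_ : NonZero k}}
  (y : ℕ → Fin ℓ) (U : ℕ → Fin ℓ → Fin ℓ)
  (y-block : ∀ n t → suc t < k + k → y (k * n + t) ≡ U t (y n)) where

  Order : Set
  Order = Table ℓ (suc ℓ)

  -- A property of the starting position, not of the word: equally ranked factors may differ, and
  -- the residue of the position matters below.
  Least : (Fin ℓ → ℕ) → ℕ → ℕ → Set
  Least v N i = ∀ j → Lex≤ N (λ n → v (y (i + n))) (λ n → v (y (j + n)))

  -- The ranks of the `k` letters from offset `d` on, packed into one numeral, so that `<` on
  -- numbers is the lexicographic order of blocks under `P`.
  blockRank : Order → Fin k → Fin ℓ → ℕ
  blockRank P d u = value (suc ℓ) (λ s → rank P (U (toℕ d + s) u)) k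

  next : Order → Fin k → Order
  next P d = compress (blockRank P d)

  rank-< : ∀ P u → rank P u < suc ℓ
  rank-< P u = toℕ<n (P ! u)

  blockRank-< : ∀ P d u → blockRank P d u < suc ℓ ^ k
  blockRank-< P d u = value-< {suc ℓ} k (λ s → rank-< P (U (toℕ d + s) u))

  y-shift : ∀ i (d : Fin k) n s → s < k → y (k * i + toℕ d + (k * n + s)) ≡ U (toℕ d + s) (y (i + n))
  y-shift i d n s s<k = trans
    (cong y (solve 5 (λ k i d n s → k :* i :+ d :+ (k :* n :+ s) := k :* (i :+ n) :+ (d :+ s))
               refl k i (toℕ d) n s))
    (y-block (i + n) (toℕ d + s)
      -- Both `d` and `s` are at most k - 1, so their sum stays within the range 2k - 2 of
      -- `y-block`.
      (≤-trans (≤-reflexive (cong suc (sym (+-suc _ s)))) (+-mono-≤ (toℕ<n d) s<k)))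
    where open +-*-Solver

  value-shift : ∀ P (d : Fin k) i N →
    value (suc ℓ) (λ n → rank P (y (k * i + toℕ d + n))) (k * N) ≡
    value (suc ℓ ^ k) (λ n → blockRank P d (y (i + n))) N
  value-shift P d i N = trans (value-blocks (suc ℓ) _ k N)
    (value-cong (suc ℓ ^ k) N (λ n _ → value-cong (suc ℓ) k (λ s s<k →
      cong (rank P) (y-shift i d n s s<k))))

  Least-compress : ∀ v {N i} → Least v N i → Least (rank (compress v)) N i
  Least-compress v least j = Lex≤-map (λ _ → compress-≡ v) (λ _ → compress-< v) (least j)

  Least-restrict : ∀ v {N M} i → N ≤ M → Least v M i → Least v N i
  Least-restrict v i N≤M least j = Lex≤-restrict N≤M (least j)

  -- It suffices to compete against positions `k * j + toℕ d` of the same residue, whose factors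
  -- split into blocks determined by the letters from `j` on.
  Least-next : ∀ P d {N i} → Least (rank P) (k * N) (k * i + toℕ d) → Least (rank (next P d)) N i
  Least-next P d {N} {i} least = Least-compress (blockRank P d) (λ j →
    value-≤⇒Lex≤ N (λ _ → blockRank-< P d _)
      (subst₂ _≤_ (value-shift P d i N) (value-shift P d j N)
        (Lex≤⇒value-≤ (k * N) (λ _ → rank-< P _) (least (k * j + toℕ d)))))

  Least-unique : ∀ P {N i j n} → Least (rank P) N i → Least (rank P) N j → n < N →
    rank P (y (i + n)) ≡ rank P (y (j + n))
  Least-unique P {N} {i} {j} {n} least-i least-j n<N =
    value-injective N (λ _ → rank-< P _) (λ _ → rank-< P _)
      (≤-antisym (Lex≤⇒value-≤ N (λ _ → rank-< P _) (least-i j))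
                 (Lex≤⇒value-≤ N (λ _ → rank-< P _) (least-j i))) n n<N

  ∃-Least : ∀ P N → ¬ ¬ (∃[ i ] Least (rank P) N i)
  ∃-Least P N = ¬¬-map
    (λ (i , min) → i , λ j → value-≤⇒Lex≤ N (λ _ → rank-< P _) (min j))
    (¬¬-minimum (λ i → value (suc ℓ) (λ n → rank P (y (i + n))) N))

  GoodResidue : Order → Fin k → Set
  GoodResidue P d = ∀ N → ¬ ¬ (∃[ i ] Least (rank P) N (k * i + toℕ d))

  -- If every residue failed at some length, a least factor longer than all these lengths would, cut
  -- down, refute the failure of its own residue.
  ∃-GoodResidue : ∀ P → ¬ ¬ (∃[ d ] GoodResidue P d)
  ∃-GoodResidue P none = ¬¬-sequence fails λ bad →
    let N = bound (λ d → proj₁ (bad d)) in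
    ∃-Least P N λ (i , least) →
      proj₂ (bad (i mod k)) (i / k , Least-restrict (rank P) _ (≤-bound (λ d → proj₁ (bad d)) (i mod k))
        (subst (Least (rank P) N) (sym (divide k i)) least))
    where
    fails : ∀ d → ¬ ¬ (∃[ N ] ¬ (∃[ i ] Least (rank P) N (k * i + toℕ d)))
    fails d never = none (d , λ N ¬least → never (N , ¬least))

    bound : ∀ {n} → (Fin n → ℕ) → ℕ
    bound {zero}  v = 0
    bound {suc n} v = v zero + bound (v ∘ suc)

    ≤-bound : ∀ {n} (v : Fin n → ℕ) i → v i ≤ bound v
    ≤-bound v zero    = m≤m+n _ _
    ≤-bound v (suc i) = ≤-trans (≤-bound (v ∘ suc) i) (m≤n+m _ (v zero))

  LeastLetter : Order → Fin ℓ → Set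
  LeastLetter P u = ∃[ i ] Least (rank P) 1 i × u ≡ y (i + 0)

  ∃-LeastLetter : ∀ P → ¬ ¬ (∃ (LeastLetter P))
  ∃-LeastLetter P = ¬¬-map (λ (i , least) → y (i + 0) , i , least , refl) (∃-Least P 1)

  -- A state `(P , f)` stands for the sequence of `f`-images of the letters in `P`-least factors.
  State : Set
  State = Order × Table ℓ m

  Finite-State : Finite State ((suc ℓ ^ ℓ) * (m ^ ℓ))
  Finite-State = Finite-× Finite-Table Finite-Table

  -- Constancy of `f` on rank classes, which makes the output independent of the least factor
  -- chosen.
  Monotone : State → Set
  Monotone (P , f) = ∀ {u w} → rank P u ≡ rank P w → f ! u ≡ f ! w

  module LeastMachine
    (residue : Order → Fin k) (residue-good : ∀ P → GoodResidue P (residue P))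
    (letter : Order → Fin ℓ) (letter-least : ∀ P → LeastLetter P (letter P)) where

    -- The digit selects a letter inside the block, so it affects only the output table; the next
    -- order depends on `P` alone.
    δ : State → Fin k → State
    δ (P , f) s = next P (residue P) , tabulate (λ u → f ! U (toℕ (residue P) + toℕ s) u)

    τ : State → Fin m
    τ (P , f) = f ! letter P

    δ-monotone : ∀ q s → Monotone q → Monotone (δ q s)
    δ-monotone (P , f) s mono {u} {w} eq = begin
      proj₂ (δ (P , f) s) ! u ≡⟨ !-tabulate _ u ⟩
      f ! U t u               ≡⟨ mono digit≡ ⟩
      f ! U t w               ≡⟨ !-tabulate _ w ⟨
      proj₂ (δ (P , f) s) ! w ∎
      where
      open ≡-Reasoning
      t = toℕ (residue P) + toℕ s
      digit≡ : rank P (U t u) ≡ rank P (U t w)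
      digit≡ = value-injective k (λ _ → rank-< P _) (λ _ → rank-< P _)
                 (compress-≡⁻¹ (blockRank P (residue P)) eq) (toℕ s) (toℕ<n s)

    -- Induction on the digits. The given position `i` may have the wrong residue, so the argument
    -- moves to a least factor of the good residue and back by `Least-unique`.
    correct : ∀ w q {i} → Monotone q → Least (rank (proj₁ q)) (suc (lsbVal k w)) i →
      τ (foldl δ q w) ≡ proj₂ q ! y (i + lsbVal k w)
    correct [] (P , f) mono least with letter-least P
    ... | j , least-j , eq = trans (cong (f !_) eq) (mono (Least-unique P least-j least ≤-refl))
    correct (s ∷ w) (P , f) {i} mono least =
      -- Equality of outputs is decidable, so a factor known only under double negation may be used.
      -- Its length is n + 1 whole blocks, enough to cover offset `k * n + toℕ s`.
      decidable-stable (_ Fin.≟ _) (¬¬-map agree (residue-good P (k * suc n)))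
      where
      open ≡-Reasoning
      n = lsbVal k w
      d = residue P
      agree : ∃[ j ] Least (rank P) (k * suc n) (k * j + toℕ d) →
        τ (foldl δ (P , f) (s ∷ w)) ≡ f ! y (i + (k * n + toℕ s))
      agree (j , least-j) = begin
        τ (foldl δ (δ (P , f) s) w)
          ≡⟨ correct w (δ (P , f) s) (δ-monotone (P , f) s mono) (Least-next P d least-j) ⟩
        proj₂ (δ (P , f) s) ! y (j + n)
          ≡⟨ !-tabulate _ (y (j + n)) ⟩
        f ! U (toℕ d + toℕ s) (y (j + n))
          ≡⟨ cong (f !_) (y-shift j d n (toℕ s) (toℕ<n s)) ⟨
        f ! y (k * j + toℕ d + (k * n + toℕ s))
          ≡⟨ mono (Least-unique P (Least-restrict (rank P) _ in-block least-j) least ≤-refl) ⟩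
        f ! y (i + (k * n + toℕ s)) ∎
        where
        in-block : suc (k * n + toℕ s) ≤ k * suc n
        in-block = ≤-trans (≤-reflexive (sym (+-suc (k * n) (toℕ s))))
          (≤-trans (+-monoʳ-≤ (k * n) (toℕ<n s))
            (≤-reflexive (trans (+-comm (k * n) k) (sym (*-suc k n)))))

  ∃-LeastMachine : ∀ (v : Fin ℓ → ℕ) (f : Fin ℓ → Fin m) → (∀ {u w} → v u ≡ v w → f u ≡ f w) →
    ¬ ¬ (∃[ M ] ∀ w i → Least v (suc (lsbVal k w)) i →
      run {k} {m} {State} M w ≡ f (y (i + lsbVal k w)))
  ∃-LeastMachine v f mono none =
    ¬¬-Π Finite-Table ∃-GoodResidue λ good →
    ¬¬-Π Finite-Table ∃-LeastLetter λ least →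
    let open LeastMachine (proj₁ ∘ good) (proj₂ ∘ good) (proj₁ ∘ least) (proj₂ ∘ least) in
    none ( machine δ (compress v , tabulate f) τ
         , λ w i least-i → trans
             (correct w (compress v , tabulate f) f-monotone (Least-compress v least-i))
             (!-tabulate f _))
    where
    f-monotone : Monotone (compress v , tabulate f)
    f-monotone eq = trans (!-tabulate f _)
      (trans (mono (compress-≡⁻¹ v eq)) (sym (!-tabulate f _)))

-- Insensitivity to leading zeros.

lsbVal-∷ʳ-zero : ∀ k (w : List (Fin k)) d → toℕ d ≡ 0 → lsbVal k (w ∷ʳ d) ≡ lsbVal k w
lsbVal-∷ʳ-zero k []      d d≡0 = trans (cong₂ _+_ (*-zeroʳ k) d≡0) refl
lsbVal-∷ʳ-zero k (e ∷ w) d d≡0 = cong (λ n → k * n + toℕ e) (lsbVal-∷ʳ-zero k w d d≡0)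

-- Asked of every state, since sequences will be started from arbitrary states.
ZeroStable : ∀ {k m Q} → Machine k m Q → Set
ZeroStable M = ∀ q d → toℕ d ≡ 0 → τ (δ q d) ≡ τ q
  where open Machine M

-- Since leading zeros do not change a, the output does not change when a zero is
-- read in a reachable state. Storing the output of the last nonzero digit extends
-- this to all states.
module Latch {k m Q} (M : Machine k m Q) where
  open Machine M hiding (run)

  δ′ : Q × Fin m → Fin k → Q × Fin m
  δ′ (q , o) d with toℕ d ≟ 0
  ... | yes _ = δ q d , o
  ... | no  _ = δ q d , τ (δ q d)

  latch : Machine k m (Q × Fin m)
  latch = machine δ′ (q0 , τ q0) proj₂

  latch-stable : ZeroStable latch
  latch-stable (q , o) d d≡0 with toℕ d ≟ 0
  ... | yes _  = refl
  ... | no d≢0 = contradiction d≡0 d≢0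

  δ′-proj₁ : ∀ q d → proj₁ (δ′ q d) ≡ δ (proj₁ q) d
  δ′-proj₁ (q , o) d with toℕ d ≟ 0
  ... | yes _ = refl
  ... | no  _ = refl

  foldl-proj₁ : ∀ w q → proj₁ (foldl δ′ q w) ≡ foldl δ (proj₁ q) w
  foldl-proj₁ []      q = refl
  foldl-proj₁ (d ∷ w) q = trans (foldl-proj₁ w (δ′ q d)) (cong (λ p → foldl δ p w) (δ′-proj₁ q d))

  latch-generates : ∀ a → Generates M a → Generates latch a
  latch-generates a gen w = go (reverseView w)
    where
    go : ∀ {w} → Reverse w → a (lsbVal k w) ≡ run latch w
    go [] = gen []
    go (u ∶ ru ∶ʳ d) = trans step (cong proj₂ (sym (foldl-∷ʳ δ′ (q0 , τ q0) d u)))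
      where
      step : a (lsbVal k (u ∷ʳ d)) ≡ proj₂ (δ′ (foldl δ′ (q0 , τ q0) u) d)
      step with toℕ d ≟ 0
      ... | yes d≡0 = trans (cong a (lsbVal-∷ʳ-zero k u d d≡0)) (go ru)
      ... | no  _   = trans (gen (u ∷ʳ d)) (cong τ (trans (foldl-∷ʳ δ q0 d u)
                        (cong (λ q → δ q d) (sym (foldl-proj₁ u (q0 , τ q0))))))

-- The sequences generated from the individual states.

module StateSequences {k m Q} (1<k : 1 < k) (M : Machine k m Q) (stable : ZeroStable M) where
  open Machine M hiding (run)

  instance
    k≢0 : NonZero k
    k≢0 = >-nonZero (<-trans z<s 1<k)

  quotient-≤ : ∀ {n ℓ} → n ≤ suc ℓ → n / k ≤ ℓ
  quotient-≤ {zero}  _   = ≤-trans (≤-reflexive (0/n≡0 k)) z≤n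
  quotient-≤ {suc n} n≤ℓ = s≤s⁻¹ (<-≤-trans (m/n<m (suc n) k 1<k) n≤ℓ)

  lsbVal-surjective : ∀ n → ∃[ w ] lsbVal k w ≡ n
  lsbVal-surjective n = go n n ≤-refl
    where
    go : ∀ ℓ n → n ≤ ℓ → ∃[ w ] lsbVal k w ≡ n
    go zero    zero _   = [] , refl
    go (suc ℓ) n    n≤ℓ with go ℓ (n / k) (quotient-≤ n≤ℓ)
    ... | w , eq = n mod k ∷ w , trans (cong (λ v → k * v + toℕ (n mod k)) eq) (divide k n)

  -- eval ℓ reads ℓ digits of n, padding with zeros.
  eval : ℕ → Q → ℕ → Fin m
  eval zero    q n = τ q
  eval (suc ℓ) q n = eval ℓ (δ q (n mod k)) (n / k)

  eval-0 : ∀ ℓ q → eval ℓ q 0 ≡ τ q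
  eval-0 zero    q = refl
  eval-0 (suc ℓ) q = begin
    eval ℓ (δ q (0 mod k)) (0 / k) ≡⟨ cong (eval ℓ _) (0/n≡0 k) ⟩
    eval ℓ (δ q (0 mod k)) 0       ≡⟨ eval-0 ℓ _ ⟩
    τ (δ q (0 mod k))              ≡⟨ stable q _ (trans (toℕ-fromℕ< _) (m*n%n≡0 0 k)) ⟩
    τ q                            ∎
    where open ≡-Reasoning

  -- Division by `k` lowers a positive number, so `n` steps exhaust the digits of `n`; further steps
  -- read zeros, which stability absorbs.
  eval-fuel : ∀ ℓ ℓ′ q {n} → n ≤ ℓ → n ≤ ℓ′ → eval ℓ q n ≡ eval ℓ′ q n
  eval-fuel zero    ℓ′       q z≤n _    = sym (eval-0 ℓ′ q)
  eval-fuel (suc ℓ) zero     q _   z≤n  = eval-0 (suc ℓ) q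
  eval-fuel (suc ℓ) (suc ℓ′) q n≤ℓ n≤ℓ′ = eval-fuel ℓ ℓ′ _ (quotient-≤ n≤ℓ) (quotient-≤ n≤ℓ′)

  seqFrom : Q → Seq m
  seqFrom q n = eval n q n

  seqFrom-step : ∀ q n d → seqFrom q (k * n + toℕ d) ≡ seqFrom (δ q d) n
  seqFrom-step q n d = begin
    eval N q N                       ≡⟨ eval-fuel N (suc N) q ≤-refl (n≤1+n N) ⟩
    eval N (δ q (N mod k)) (N / k)   ≡⟨ cong₂ (λ e v → eval N (δ q e) v) N-mod N-div ⟩
    eval N (δ q d) n
      ≡⟨ eval-fuel N n _ (≤-trans (m≤n*m n k) (m≤m+n (k * n) (toℕ d))) ≤-refl ⟩
    eval n (δ q d) n                 ∎
    where
    open ≡-Reasoning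
    N = k * n + toℕ d
    N≡ : N ≡ toℕ d + n * k
    N≡ = trans (+-comm (k * n) (toℕ d)) (cong (toℕ d +_) (*-comm k n))
    N-mod : N mod k ≡ d
    N-mod = toℕ-injective (trans (toℕ-fromℕ< _) (trans (cong (_% k) N≡)
              (trans ([m+kn]%n≡m%n (toℕ d) n k) (m<n⇒m%n≡m (toℕ<n d)))))
    N-div : N / k ≡ n
    N-div = *-cancelˡ-≡ _ _ k (+-cancelʳ-≡ (toℕ d) _ _
              (trans (cong (λ e → k * (N / k) + toℕ e) (sym N-mod)) (divide k N)))

  seqFrom-lsbVal : ∀ w q → seqFrom q (lsbVal k w) ≡ τ (foldl δ q w)
  seqFrom-lsbVal []      q = refl
  seqFrom-lsbVal (d ∷ w) q = trans (seqFrom-step q (lsbVal k w) d) (seqFrom-lsbVal w (δ q d))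

  seqFrom-generated : ∀ {a} → Generates M a → ∀ n → seqFrom q0 n ≡ a n
  seqFrom-generated gen n with lsbVal-surjective n
  ... | w , refl = trans (seqFrom-lsbVal w q0) (sym (gen w))

funToFin-cong : ∀ {m n} {f g : Fin m → Fin n} → f ≗ g → funToFin f ≡ funToFin g
funToFin-cong {zero}  f≗g = refl
funToFin-cong {suc m} f≗g = cong₂ combine (f≗g zero) (funToFin-cong (f≗g ∘ suc))

-- Recovering an automaton by finite search.

module _ {k : ℕ} where

  module Shorten {Q n} (F : Finite Q n) (δ : Q → Fin k → Q) where
    open Finite F

    enc-injective : ∀ {p q} → enc p ≡ enc q → p ≡ q
    enc-injective {p} {q} eq = trans (sym (dec-enc p)) (trans (cong dec eq) (dec-enc q))

    -- Pumping: among the n + 1 prefixes of lengths 0 to n two reach the same state, and the piece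
    -- between them is cut out.
    shorten : ∀ q w → n < length w → ∃[ v ] length v < length w × foldl δ q v ≡ foldl δ q w
    shorten q w n<len with Fin.pigeonhole (n<1+n n) (λ i → enc (foldl δ q (take (toℕ i) w)))
    ... | i , j , i<j , eq = v , shorter , same
      where
      v = take (toℕ i) w ++ drop (toℕ j) w
      j≤len : toℕ j ≤ length w
      j≤len = <⇒≤ (≤-<-trans (s≤s⁻¹ (toℕ<n j)) n<len)
      shorter : length v < length w
      shorter = begin-strict
        length v                                           ≡⟨ length-++ (take (toℕ i) w) ⟩
        length (take (toℕ i) w) + length (drop (toℕ j) w)
          ≡⟨ cong₂ _+_ (length-take (toℕ i) w) (length-drop (toℕ j) w) ⟩
        toℕ i ⊓ length w + (length w ∸ toℕ j)              ≤⟨ +-monoˡ-≤ _ (m⊓n≤m (toℕ i) _) ⟩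
        toℕ i + (length w ∸ toℕ j)                         <⟨ +-monoˡ-< _ i<j ⟩
        toℕ j + (length w ∸ toℕ j)                         ≡⟨ m+[n∸m]≡n j≤len ⟩
        length w                                           ∎
        where open ≤-Reasoning
      same : foldl δ q v ≡ foldl δ q w
      same = begin
        foldl δ q v                                          ≡⟨ foldl-++ δ q (take (toℕ i) w) _ ⟩
        foldl δ (foldl δ q (take (toℕ i) w)) (drop (toℕ j) w)
          ≡⟨ cong (λ p → foldl δ p (drop (toℕ j) w)) (enc-injective eq) ⟩
        foldl δ (foldl δ q (take (toℕ j) w)) (drop (toℕ j) w) ≡⟨ foldl-++ δ q (take (toℕ j) w) _ ⟨
        foldl δ q (take (toℕ j) w ++ drop (toℕ j) w)
          ≡⟨ cong (foldl δ q) (take++drop≡id (toℕ j) w) ⟩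
        foldl δ q w                                          ∎
        where open ≡-Reasoning

    short⇒all : ∀ {R : Q → Set} q → (∀ w → length w ≤ n → R (foldl δ q w)) → ∀ w → R (foldl δ q w)
    short⇒all {R} q short w = go (length w) w ≤-refl
      where
      go : ∀ L w → length w ≤ L → R (foldl δ q w)
      go zero    w len≤L = short w (≤-trans len≤L z≤n)
      go (suc L) w len≤L with length w ≤? n
      ... | yes len≤n = short w len≤n
      ... | no  len≰n with shorten q w (≰⇒> len≰n)
      ...   | v , v<w , same = subst R same (go L v (s≤s⁻¹ (<-≤-trans v<w len≤L)))

  allShort? : ∀ {P : List (Fin k) → Set} → (∀ w → Dec (P w)) → ∀ L → Dec (∀ w → length w ≤ L → P w)
  allShort? P? zero    = map′ (λ { p [] _ → p }) (λ p → p [] z≤n) (P? [])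
  allShort? P? (suc L) = map′
    (λ { (p , ps) [] _ → p ; (p , ps) (d ∷ w) (s≤s len≤L) → ps d w len≤L })
    (λ p → p [] z≤n , λ d w len≤L → p (d ∷ w) (s≤s len≤L))
    (P? [] ×-dec Fin.all? (λ d → allShort? (λ w → P? (d ∷ w)) L))

  module _ {m S T : ℕ} (M : Machine k m (Fin S)) (N : Machine k m (Fin T)) where
    private
      module M = Machine M
      module N = Machine N

    pairStep : Fin S × Fin T → Fin k → Fin S × Fin T
    pairStep (p , q) d = M.δ p d , N.δ q d

    foldl-pairStep : ∀ w p q → foldl pairStep (p , q) w ≡ (foldl M.δ p w , foldl N.δ q w)
    foldl-pairStep []      p q = refl
    foldl-pairStep (d ∷ w) p q = foldl-pairStep w (M.δ p d) (N.δ q d)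

    -- Equality of outputs depends only on the state reached in the product machine, which has
    -- `S * T` states.
    runs-agree : (∀ w → length w ≤ S * T → run M w ≡ run N w) → ∀ w → run M w ≡ run N w
    runs-agree short w = subst R (foldl-pairStep w M.q0 N.q0)
      (Shorten.short⇒all (Finite-× Finite-Fin Finite-Fin) pairStep {R} (M.q0 , N.q0)
        (λ w len → subst R (sym (foldl-pairStep w M.q0 N.q0)) (short w len)) w)
      where
      R : Fin S × Fin T → Set
      R (p , q) = M.τ p ≡ N.τ q

  MachineCode : ℕ → ℕ → Set
  MachineCode m S = Table (S * k) S × Fin S × Table S m

  Finite-MachineCode : ∀ {m S} → Finite (MachineCode m S) (S ^ (S * k) * (S * m ^ S))
  Finite-MachineCode = Finite-× Finite-Table (Finite-× Finite-Fin Finite-Table)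

  decodeMachine : ∀ {m S} → MachineCode m S → Machine k m (Fin S)
  decodeMachine (Δ , q0 , T) = machine (λ q d → Δ ! combine q d) q0 (T !_)

  encodeMachine : ∀ {m S} → Machine k m (Fin S) → MachineCode m S
  encodeMachine {S = S} (machine δ q0 τ) =
    tabulate (λ i → δ (proj₁ (remQuot {S} k i)) (proj₂ (remQuot {S} k i))) , q0 , tabulate τ

  run-encodeMachine : ∀ {m S} (M : Machine k m (Fin S)) w →
    run (decodeMachine (encodeMachine M)) w ≡ run M w
  run-encodeMachine {S = S} M@(machine δ q0 τ) w = trans (!-tabulate τ _) (cong τ (go w q0))
    where
    Δ = Machine.δ (decodeMachine (encodeMachine M))
    Δ≡δ : ∀ q d → Δ q d ≡ δ q d
    Δ≡δ q d = trans (!-tabulate _ (combine q d))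
      (cong (λ qd → δ (proj₁ qd) (proj₂ qd)) (remQuot-combine {S} {k} q d))
    go : ∀ w q → foldl Δ q w ≡ foldl δ q w
    go []      q = refl
    go (d ∷ w) q = trans (go w (Δ q d)) (cong (λ p → foldl δ p w) (Δ≡δ q d))

  -- A candidate passing the bounded test agrees with the hypothetical machine on short words, hence
  -- on all. If none passes, the code of that machine is a contradiction.
  generated-stable : ∀ {m} S (b : Seq m) →
    ¬ ¬ (∃[ M ] Generates {k} {m} {Fin S} M b) → ∃[ M ] Generates {k} {m} {Fin S} M b
  generated-stable {m} S b ¬¬gen = case search of λ
    { (yes (i , short)) → candidate i , λ w → decidable-stable (_ Fin.≟ _)
        (¬¬-map (λ (M , gen) → trans (gen w)
          (runs-agree M (candidate i) (λ v len → trans (sym (gen v)) (short v len)) w)) ¬¬gen)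
    ; (no none) → contradiction
        (λ (M , gen) → none (enc (encodeMachine M) , λ w _ →
          trans (gen w) (trans (sym (run-encodeMachine M w))
            (cong (λ c → run (decodeMachine c) w) (sym (dec-enc (encodeMachine M))))))) ¬¬gen
    }
    where
    open Finite (Finite-MachineCode {m} {S})
    candidate : Fin (S ^ (S * k) * (S * m ^ S)) → Machine k m (Fin S)
    candidate i = decodeMachine (dec i)
    search : Dec (∃[ i ] ∀ w → length w ≤ S * S → b (lsbVal k w) ≡ run (candidate i) w)
    search = Fin.any? (λ i → allShort? (λ w → _ Fin.≟ _) (S * S))

-- The block alphabet.

module BlockLetters {k m Q n} (1<k : 1 < k) (FQ : Finite Q n)
  (M : Machine k m Q) (stable : ZeroStable M) where
  open StateSequences 1<k M stable
  open Machine M hiding (run)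
  open Finite (Finite-× (Finite-Fin {2}) FQ)

  ℓ : ℕ
  ℓ = m ^ (2 * n)

  window : Fin 2 × Q → ℕ → Fin m
  window (c , q) i = seqFrom q (toℕ c + i)

  -- The quotient of `t + toℕ c` by `k` is the carry into the next position, and `mod 2` only places
  -- it in `Fin 2`.
  windowStep : ℕ → Fin 2 × Q → Fin 2 × Q
  windowStep t (c , q) = (t + toℕ c) / k mod 2 , δ q ((t + toℕ c) mod k)

  window-step : ∀ i t p → suc t < k + k → window p (k * i + t) ≡ window (windowStep t p) i
  window-step i t (c , q) t< = begin
    seqFrom q (toℕ c + (k * i + t))                    ≡⟨ cong (seqFrom q) split ⟩
    seqFrom q (k * (v / k + i) + toℕ (v mod k))        ≡⟨ seqFrom-step q (v / k + i) (v mod k) ⟩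
    seqFrom (δ q (v mod k)) (v / k + i)
      ≡⟨ cong (λ e → seqFrom (δ q (v mod k)) (e + i)) carry ⟨
    seqFrom (δ q (v mod k)) (toℕ (v / k mod 2) + i)    ∎
    where
    open ≡-Reasoning
    open +-*-Solver
    v = t + toℕ c
    split : toℕ c + (k * i + t) ≡ k * (v / k + i) + toℕ (v mod k)
    split = begin
      toℕ c + (k * i + t)
        ≡⟨ solve 3 (λ c x t → c :+ (x :+ t) := x :+ (t :+ c)) refl (toℕ c) (k * i) t ⟩
      k * i + v                                 ≡⟨ cong (k * i +_) (divide k v) ⟨
      k * i + (k * (v / k) + toℕ (v mod k))
        ≡⟨ solve 4 (λ k i e r → k :* i :+ (k :* e :+ r) := k :* (e :+ i) :+ r)
             refl k i (v / k) (toℕ (v mod k)) ⟩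
      k * (v / k + i) + toℕ (v mod k)           ∎
    -- With t ≤ 2k - 2 and c ≤ 1 the carry is 0 or 1; this is why two adjacent values per state
    -- suffice.
    v<2k : v < 2 * k
    v<2k = ≤-trans (s≤s (≤-trans (+-monoʳ-≤ t (s≤s⁻¹ (toℕ<n c))) (≤-reflexive (+-comm t 1))))
             (≤-trans t< (≤-reflexive (cong (k +_) (sym (+-identityʳ k)))))
    carry : toℕ (v / k mod 2) ≡ v / k
    carry = trans (toℕ-fromℕ< _) (m<n⇒m%n≡m (m<n*o⇒m/o<n v<2k))

  letterAt : ℕ → Fin ℓ
  letterAt i = funToFin (λ p → window (dec p) i)

  letterStep : ℕ → Fin ℓ → Fin ℓ
  letterStep t u = funToFin (λ p → finToFun {m} {2 * n} u (enc (windowStep t (dec p))))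

  letterAt-step : ∀ i t → suc t < k + k → letterAt (k * i + t) ≡ letterStep t (letterAt i)
  letterAt-step i t t< = funToFin-cong λ p → begin
    window (dec p) (k * i + t)                              ≡⟨ window-step i t (dec p) t< ⟩
    window (windowStep t (dec p)) i
      ≡⟨ cong (λ r → window r i) (dec-enc (windowStep t (dec p))) ⟨
    window (dec (enc (windowStep t (dec p)))) i
      ≡⟨ finToFun-funToFin (λ p → window (dec p) i) (enc (windowStep t (dec p))) ⟨
    finToFun (letterAt i) (enc (windowStep t (dec p)))      ∎
    where open ≡-Reasoning

  firstEntry : Fin ℓ → Fin m
  firstEntry u = finToFun {m} {2 * n} u (enc (zero , q0))

  firstEntry-letterAt : ∀ {a} → Generates M a → ∀ i → firstEntry (letterAt i) ≡ a i
  firstEntry-letterAt {a} gen i = begin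
    firstEntry (letterAt i)
      ≡⟨ finToFun-funToFin (λ p → window (dec p) i) (enc (zero , q0)) ⟩
    window (dec (enc (zero , q0))) i   ≡⟨ cong (λ r → window r i) (dec-enc (zero , q0)) ⟩
    seqFrom q0 i                       ≡⟨ seqFrom-generated {a} gen i ⟩
    a i                                ∎
    where open ≡-Reasoning

-- Digit strings in either direction, and the least sequence.

Automatic⇒Generates : ∀ {k m} (a : Seq m) → Automatic k a →
  ∃[ S ] ∃[ M ] Generates {k} {m} {Fin S} M a
Automatic⇒Generates {k} a (S , δ , q0 , τ , gen) = S , machine δ q0 τ , λ w → begin
  a (lsbVal k w)                         ≡⟨ cong a (reverse-foldl _ 0 w) ⟨
  a (val k (reverse w))                  ≡⟨ gen (reverse w) ⟩
  τ (foldl δ q0 (reverse (reverse w)))   ≡⟨ cong (λ v → τ (foldl δ q0 v)) (reverse-involutive w) ⟩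
  τ (foldl δ q0 w)                       ∎
  where open ≡-Reasoning

Generates⇒Automatic : ∀ {k m S} (a : Seq m) →
  ∃[ M ] Generates {k} {m} {Fin S} M a → Automatic k a
Generates⇒Automatic {S = S} a (machine δ q0 τ , gen) =
  S , δ , q0 , τ , λ w → trans (cong a (sym (reverse-foldr _ 0 w))) (gen (reverse w))

LexLeq⇒Lex≤ : ∀ {m} {b c : Seq m} → LexLeq b c → ∀ N → Lex≤ N (toℕ ∘ b) (toℕ ∘ c)
LexLeq⇒Lex≤ (inj₁ eq) N = inj₁ (λ n _ → cong toℕ (eq n))
LexLeq⇒Lex≤ (inj₂ (p , eq , lt)) N with p <? N
... | yes p<N = inj₂ (p , p<N , (λ n n<p → cong toℕ (eq n n<p)) , lt)
... | no  p≮N = inj₁ (λ n n<N → cong toℕ (eq n (<-≤-trans n<N (≮⇒≥ p≮N))))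

Lex≤-respˡ : ∀ {N g g′ h} → AgreeBelow N g g′ → Lex≤ N g h → Lex≤ N g′ h
Lex≤-respˡ g≡g′ (inj₁ eq) = inj₁ (λ n n<N → trans (sym (g≡g′ n n<N)) (eq n n<N))
Lex≤-respˡ {h = h} g≡g′ (inj₂ (p , p<N , eq , lt)) =
  inj₂ (p , p<N , (λ n n<p → trans (sym (g≡g′ n (<-trans n<p p<N))) (eq n n<p))
         , subst (_< h p) (g≡g′ p p<N) lt)

theorem5 : (k : ℕ) → 2 ≤ k → (m : ℕ) → (a b : Seq m) →
    Automatic k a → IsLexLeastInOrbitClosure a b → Automatic k b
theorem5 k 1<k m a b automatic (b∈orbit , b-least)
  with S , M , gen ← Automatic⇒Generates a automatic =
  -- The omitted state count comes from `Finite-State` and is fixed before the double negation is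
  -- entered.
  Generates⇒Automatic b (generated-stable _ b (¬¬-map
    (λ (L , L-least) → encode Finite-State L , λ w →
      trans (b-generated L L-least w) (sym (run-encode Finite-State L w)))
    -- The initial preorder is the order of the alphabet on the entry of `a` in each letter.
    (∃-LeastMachine (toℕ ∘ firstEntry) firstEntry toℕ-injective)))
  where
  open Latch M
  open StateSequences 1<k latch latch-stable using (k≢0)
  open BlockLetters 1<k (Finite-× Finite-Fin Finite-Fin) latch latch-stable
  open Blocks k ℓ m letterAt letterStep letterAt-step

  entry : ∀ i → firstEntry (letterAt i) ≡ a i
  entry = firstEntry-letterAt {a} (latch-generates a gen)

  -- Every shift of `a` lies in the orbit closure, so `b` is at most each of them, and position `i`
  -- carries the prefix of `b`.
  prefix-least : ∀ N {i} → (∀ n → n < N → b n ≡ a (i + n)) → Least (toℕ ∘ firstEntry) N i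
  prefix-least N {i} prefix j = Lex≤-respˡ
    (λ n n<N → cong toℕ (trans (prefix n n<N) (sym (entry (i + n)))))
    (Lex≤-map (λ n → subst (λ x → toℕ (b n) ≡ toℕ x) (sym (entry (j + n))))
              (λ n → subst (λ x → toℕ (b n) < toℕ x) (sym (entry (j + n))))
              (LexLeq⇒Lex≤ (b-least (λ n → a (j + n)) (λ _ → j , λ _ _ → refl)) N))

  b-generated : ∀ L → (∀ w i → Least (toℕ ∘ firstEntry) (suc (lsbVal k w)) i →
    run L w ≡ firstEntry (letterAt (i + lsbVal k w))) → Generates L b
  b-generated L L-least w with b∈orbit (suc (lsbVal k w))
  ... | i , prefix = begin
    b n                             ≡⟨ prefix n ≤-refl ⟩
    a (i + n)                       ≡⟨ entry (i + n) ⟨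
    firstEntry (letterAt (i + n))   ≡⟨ L-least w i (prefix-least (suc n) prefix) ⟨
    run L w                         ∎
    where
    open ≡-Reasoning
    n = lsbVal k w
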